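{- Let $E$ be a finite set, let $f:\mathbb{Z}_+^E\to\mathbb{R}_+$ be a DR-submodular function, and let $B_i$ ($i\in E$) be positive integers. For each $i\in E$ let $B_i=a_{i,1}+\cdots+a_{i,t_i}$ be a decomposition into positive integers with $t_i\le 2\log B_i+1$ such that every integer $q$ with $0\le q\le B_i$ is the sum of a subset of the multiset $\{a_{i,1},\ldots,a_{i,t_i}\}$. Let $E'=\bigcup_{i\in E}\{(i,1),\ldots,(i,t_i)\}$, and define $g:\{0,1\}^{E'}\to\mathbb{R}_+$ by $g(\mathbf{y}):=f(\mathbf{x})$, where $\mathbf{x}\in\mathbb{Z}_+^E$ is given by $x_i=\sum_{j=1}^{t_i}y_{i,j}\,a_{i,j}$ for all $i\in E$. Then $g$ is submodular.
   Context: $\mathbb{Z}_+$ and $\mathbb{R}_+$ denote the nonnegative integers and nonnegative reals. For $i\in E$, $\chi_i\in\{0,1\}^E$ is the vector with $1$ in coordinate $i$ and $0$ in all other coordinates; inequalities between vectors are coordinatewise. A function $f:\mathbb{Z}_+^E\to\mathbb{R}_+$ is DR-submodular if $f(\mathbf{x}+\chi_i)-f(\mathbf{x})\ge f(\mathbf{y}+\chi_i)-f(\mathbf{y})$ for all $\mathbf{x}\le\mathbf{y}$ in $\mathbb{Z}_+^E$ and all $i\in E$. Here $\log$ is the logarithm to base $2$. Vectors in $\{0,1\}^{E'}$ are identified with subsets of $E'$, and $g$ is submodular if $g(\mathbf{y}+\chi_e)-g(\mathbf{y})\ge g(\mathbf{y}'+\chi_e)-g(\mathbf{y}')$ whenever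 $\mathbf{y}\le\mathbf{y}'$ in $\{0,1\}^{E'}$ and $e\in E'$ satisfies $y'_e=0$, where $\chi_e\in\{0,1\}^{E'}$ is the indicator vector of $e$. -}

module Defs where

open import Algebra.Bundles.Raw using (RawMonoid)
import Algebra.Definitions.RawMonoid as RawMonoidOperations
open import Algebra.Properties.CommutativeMonoid.Sum as CommutativeMonoidSum using ()
open import Data.Bool.Base as Bool using (Bool; false; _∨_; if_then_else_)
open import Data.Fin.Base using (Fin)
import Data.Fin.Properties as Fin
open import Data.Integer.Base as ℤ using (+_; +[1+_])
import Data.Integer.Properties as ℤ
open import Data.Nat.Base as ℕ using (ℕ; zero; suc; NonZero; ⌊_/2⌋)
import Data.Nat.Properties as ℕ
open import Data.Nat.Induction using (<-wellFounded)
open import Data.Nat.Logarithm using (⌊log₂_⌋; ⌊log₂⌋-mono-≤; ⌊log₂[2^n]⌋≡n)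
open import Data.Nat.Logarithm.Core using (⌊log2⌋)
open import Data.Product.Base using (Σ; ∃-syntax; _×_; _,_; proj₁; proj₂)
import Data.Product.Properties as Product
open import Data.Rational.Base as ℚ using (ℚ; 0ℚ; 1ℚ; ½; ∣_∣; mkℚ)
import Data.Rational.Properties as ℚ
import Data.Rational.Unnormalised.Base as ℚᵘ
import Data.Rational.Unnormalised.Properties as ℚᵘ
open import Data.Rational.Solver using (module +-*-Solver)
open import Data.Sum.Base using (inj₁; inj₂)
open import Data.Vec.Base using (Vec; replicate; tabulate; zipWith; _[_]≔_)
open import Data.Vec.Functional using (Vector)
open import Data.Vec.Relation.Binary.Pointwise.Inductive using (Pointwise)
open import Induction.WellFounded using (Acc; acc)
open import Level using (0ℓ)
open import Relation.Binary.Definitions using (DecidableEquality)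
open import Relation.Binary.PropositionalEquality
  using (_≡_; refl; sym; trans; cong; subst; subst₂)
open import Relation.Nullary.Decidable.Core using (does)

open CommutativeMonoidSum ℕ.+-0-commutativeMonoid using (sum; sum-syntax)

private
  halves : ∀ ε → ½ ℚ.* ε ℚ.+ ½ ℚ.* ε ≡ ε
  halves ε = trans (sym (ℚ.*-distribʳ-+ ε ½ ½)) (ℚ.*-identityˡ ε)

  half>0 : ∀ {ε} → 0ℚ ℚ.< ε → 0ℚ ℚ.< ½ ℚ.* ε
  half>0 {ε} ε>0 = subst (ℚ._< ½ ℚ.* ε) (ℚ.*-zeroʳ ½) (ℚ.*-monoʳ-<-pos ½ ε>0)

  ∣-∣<-intro : ∀ {p q} → p ℚ.< q → ℚ.- p ℚ.< q → ∣ p ∣ ℚ.< q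
  ∣-∣<-intro {p} {q} p<q -p<q with ℚ.∣p∣≡p∨∣p∣≡-p p
  ... | inj₁ eq = subst (ℚ._< q) (sym eq) p<q
  ... | inj₂ eq = subst (ℚ._< q) (sym eq) -p<q

  rearrange-+ : ∀ a b c d → (a ℚ.+ b) ℚ.- (c ℚ.+ d) ≡ (a ℚ.- c) ℚ.+ (b ℚ.- d)
  rearrange-+ = solve 4 (λ a b c d →
    (a :+ b) :- (c :+ d) := (a :- c) :+ (b :- d)) refl
    where open +-*-Solver

  swap-- : ∀ a b → ℚ.- (a ℚ.- b) ≡ b ℚ.- a
  swap-- = solve 2 (λ a b → :- (a :- b) := b :- a) refl
    where open +-*-Solver

  neg-- : ∀ a b → (ℚ.- a) ℚ.- (ℚ.- b) ≡ ℚ.- (a ℚ.- b)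
  neg-- = solve 2 (λ a b → (:- a) :- (:- b) := :- (a :- b)) refl
    where open +-*-Solver

  cancel-- : ∀ a b → (a ℚ.+ b) ℚ.- a ≡ b
  cancel-- = solve 2 (λ a b → (a :+ b) :- a := b) refl
    where open +-*-Solver

  archimedean : ∀ ε → 0ℚ ℚ.< ε →
                ∃[ N ] (∀ n → N ℕ.≤ n → (+ 1) ℚ./ suc n ℚ.< ε)
  archimedean ε ε>0 with ℚ.positive ε>0
  archimedean (mkℚ +[1+ p ] d c) ε>0 | _ = suc d , λ n d<n →
    ℚ.toℚᵘ-cancel-< (ℚᵘ.<-respˡ-≃ (ℚᵘ.≃-sym (ℚ.toℚᵘ-fromℚᵘ (ℚᵘ.mkℚᵘ (+ 1) n)))
      (ℚᵘ.*<* (subst₂ ℤ._<_ (ℤ.pos-* 1 (suc d)) (ℤ.pos-* (suc p) (suc n))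
        (ℤ.+<+ (bound n d<n)))))
    where
    open ℕ.≤-Reasoning
    bound : ∀ n → suc d ℕ.≤ n → 1 ℕ.* suc d ℕ.< suc p ℕ.* suc n
    bound n d<n = begin-strict
      1 ℕ.* suc d     ≡⟨ ℕ.*-identityˡ (suc d) ⟩
      suc d           <⟨ ℕ.s≤s d<n ⟩
      suc n           ≤⟨ ℕ.m≤m+n (suc n) (p ℕ.* suc n) ⟩
      suc p ℕ.* suc n ∎

  /-cross-≤ : ∀ k l m n → k ℕ.* suc n ℕ.≤ l ℕ.* suc m →
              (+ k) ℚ./ suc m ℚ.≤ (+ l) ℚ./ suc n
  /-cross-≤ k l m n le = ℚ.toℚᵘ-cancel-≤
    (ℚᵘ.≤-respˡ-≃ (ℚᵘ.≃-sym (ℚ.toℚᵘ-fromℚᵘ (ℚᵘ.mkℚᵘ (+ k) m)))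
    (ℚᵘ.≤-respʳ-≃ (ℚᵘ.≃-sym (ℚ.toℚᵘ-fromℚᵘ (ℚᵘ.mkℚᵘ (+ l) n)))
      (ℚᵘ.*≤* (subst₂ ℤ._≤_ (ℤ.pos-* k (suc n)) (ℤ.pos-* l (suc m))
        (ℤ.+≤+ le)))))

  /-suc : ∀ l n → (+ suc l) ℚ./ suc n ≡ (+ l) ℚ./ suc n ℚ.+ (+ 1) ℚ./ suc n
  /-suc l n = ℚ.toℚᵘ-injective (begin
    ℚ.toℚᵘ ((+ suc l) ℚ./ suc n)                     ≈⟨ ℚ.toℚᵘ-fromℚᵘ (ℚᵘ.mkℚᵘ (+ suc l) n) ⟩
    ℚᵘ.mkℚᵘ (+ suc l) n                              ≈⟨ ℚᵘ.*≡* common ⟩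
    ℚᵘ.mkℚᵘ (+ l) n ℚᵘ.+ ℚᵘ.mkℚᵘ (+ 1) n             ≈⟨ ℚᵘ.+-cong
      (ℚ.toℚᵘ-fromℚᵘ (ℚᵘ.mkℚᵘ (+ l) n)) (ℚ.toℚᵘ-fromℚᵘ (ℚᵘ.mkℚᵘ (+ 1) n)) ⟨
    ℚ.toℚᵘ ((+ l) ℚ./ suc n) ℚᵘ.+ ℚ.toℚᵘ ((+ 1) ℚ./ suc n)
      ≈⟨ ℚ.toℚᵘ-homo-+ ((+ l) ℚ./ suc n) ((+ 1) ℚ./ suc n) ⟨
    ℚ.toℚᵘ ((+ l) ℚ./ suc n ℚ.+ (+ 1) ℚ./ suc n)     ∎)
    where
    open ℚᵘ.≃-Reasoning
    s = + suc n
    common : (+ suc l) ℤ.* (s ℤ.* s) ≡ ((+ l) ℤ.* s ℤ.+ (+ 1) ℤ.* s) ℤ.* s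
    common = trans (sym (ℤ.*-assoc (+ suc l) s s)) (cong (ℤ._* s)
      (trans (cong (ℤ._* s) (cong +_ (ℕ.+-comm 1 l))) (ℤ.*-distribʳ-+ s (+ l) (+ 1))))

-- Real numbers are Cauchy sequences of rationals, with _≈_ as their equality.
record ℝ : Set where
  field
    seq    : ℕ → ℚ
    cauchy : ∀ ε → 0ℚ ℚ.< ε →
             ∃[ N ] (∀ m n → N ℕ.≤ m → N ℕ.≤ n → ∣ seq m ℚ.- seq n ∣ ℚ.< ε)

open ℝ public

infix  4 _≤_ _≥_ _≈_
infixl 6 _+_ _-_
infix  8 -_

_≤_ : ℝ → ℝ → Set
x ≤ y = ∀ ε → 0ℚ ℚ.< ε → ∃[ N ] (∀ n → N ℕ.≤ n → seq x n ℚ.≤ seq y n ℚ.+ ε)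

_≥_ : ℝ → ℝ → Set
x ≥ y = y ≤ x

_≈_ : ℝ → ℝ → Set
x ≈ y = x ≤ y × y ≤ x

fromℚ : ℚ → ℝ
fromℚ q .seq    _     = q
fromℚ q .cauchy ε ε>0 = 0 , λ _ _ _ _ →
  subst (ℚ._< ε) (sym (cong ∣_∣ (ℚ.+-inverseʳ q))) ε>0

0ℝ : ℝ
0ℝ = fromℚ 0ℚ

1ℝ : ℝ
1ℝ = fromℚ 1ℚ

fromℕ : ℕ → ℝ
fromℕ k = fromℚ ((+ k) ℚ./ 1)

_+_ : ℝ → ℝ → ℝ
(x + y) .seq    n     = seq x n ℚ.+ seq y n
(x + y) .cauchy ε ε>0 with cauchy x (½ ℚ.* ε) (half>0 ε>0) | cauchy y (½ ℚ.* ε) (half>0 ε>0)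
... | M , cx | N , cy = M ℕ.⊔ N , λ m n ≤m ≤n → begin-strict
  ∣ (seq x m ℚ.+ seq y m) ℚ.- (seq x n ℚ.+ seq y n) ∣
    ≡⟨ cong ∣_∣ (rearrange-+ (seq x m) (seq y m) (seq x n) (seq y n)) ⟩
  ∣ (seq x m ℚ.- seq x n) ℚ.+ (seq y m ℚ.- seq y n) ∣
    ≤⟨ ℚ.∣p+q∣≤∣p∣+∣q∣ (seq x m ℚ.- seq x n) (seq y m ℚ.- seq y n) ⟩
  ∣ seq x m ℚ.- seq x n ∣ ℚ.+ ∣ seq y m ℚ.- seq y n ∣
    <⟨ ℚ.+-mono-<
         (cx m n (ℕ.m⊔n≤o⇒m≤o M N ≤m) (ℕ.m⊔n≤o⇒m≤o M N ≤n))
         (cy m n (ℕ.m⊔n≤o⇒n≤o M N ≤m) (ℕ.m⊔n≤o⇒n≤o M N ≤n)) ⟩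
  ½ ℚ.* ε ℚ.+ ½ ℚ.* ε
    ≡⟨ halves ε ⟩
  ε ∎
  where open ℚ.≤-Reasoning

-_ : ℝ → ℝ
(- x) .seq    n     = ℚ.- seq x n
(- x) .cauchy ε ε>0 with cauchy x ε ε>0
... | N , cx = N , λ m n ≤m ≤n → subst (ℚ._< ε)
  (sym (trans (cong ∣_∣ (neg-- (seq x m) (seq x n))) (ℚ.∣-p∣≡∣p∣ (seq x m ℚ.- seq x n))))
  (cx m n ≤m ≤n)

_-_ : ℝ → ℝ → ℝ
x - y = x + (- y)

+-0-rawMonoid : RawMonoid 0ℓ 0ℓ
+-0-rawMonoid = record { Carrier = ℝ ; _≈_ = _≈_ ; _∙_ = _+_ ; ε = 0ℝ }

open RawMonoidOperations +-0-rawMonoid public using () renaming (_×_ to _·_)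

ℝ₊ : Set
ℝ₊ = Σ ℝ (0ℝ ≤_)

value : ℝ₊ → ℝ
value = proj₁

private
  2^⌊log2⌋≤n : ∀ n (ac : Acc ℕ._<_ n) → NonZero n → 2 ℕ.^ ⌊log2⌋ n ac ℕ.≤ n
  2^⌊log2⌋≤n 1             _        _ = ℕ.≤-refl
  2^⌊log2⌋≤n (suc (suc n)) (acc rs) _ = begin
    2 ℕ.* 2 ℕ.^ ⌊log2⌋ (suc ⌊ n /2⌋) _
      ≤⟨ ℕ.*-monoʳ-≤ 2 (2^⌊log2⌋≤n (suc ⌊ n /2⌋) _ _) ⟩
    2 ℕ.* suc ⌊ n /2⌋
      ≡⟨ cong (suc ⌊ n /2⌋ ℕ.+_) (ℕ.+-identityʳ (suc ⌊ n /2⌋)) ⟩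
    suc ⌊ n /2⌋ ℕ.+ suc ⌊ n /2⌋
      ≤⟨ ℕ.+-monoʳ-≤ (suc ⌊ n /2⌋) (ℕ.s≤s (ℕ.⌊n/2⌋≤⌈n/2⌉ n)) ⟩
    suc ⌊ n /2⌋ ℕ.+ suc ⌊ suc n /2⌋
      ≡⟨ ℕ.⌊n/2⌋+⌈n/2⌉≡n (suc (suc n)) ⟩
    suc (suc n) ∎
    where open ℕ.≤-Reasoning

  2^⌊log₂n⌋≤n : ∀ n → NonZero n → 2 ℕ.^ ⌊log₂ n ⌋ ℕ.≤ n
  2^⌊log₂n⌋≤n n = 2^⌊log2⌋≤n n (<-wellFounded n)

  n<2^[1+⌊log₂n⌋] : ∀ n → n ℕ.< 2 ℕ.^ suc ⌊log₂ n ⌋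
  n<2^[1+⌊log₂n⌋] n = ℕ.≰⇒> λ le → ℕ.1+n≰n
    (subst (ℕ._≤ ⌊log₂ n ⌋) (⌊log₂[2^n]⌋≡n (suc ⌊log₂ n ⌋)) (⌊log₂⌋-mono-≤ le))

  ⌊log₂⌋-power-cross : ∀ B .{{_ : NonZero B}} m n →
    ⌊log₂ (B ℕ.^ m) ⌋ ℕ.* n ℕ.≤ suc ⌊log₂ (B ℕ.^ n) ⌋ ℕ.* m
  ⌊log₂⌋-power-cross B m n = ℕ.≮⇒≥ λ lt → ℕ.<-irrefl refl (begin-strict
    2 ℕ.^ (a ℕ.* n)       ≡⟨ ℕ.^-*-assoc 2 a n ⟨
    (2 ℕ.^ a) ℕ.^ n       ≤⟨ ℕ.^-monoˡ-≤ n (2^⌊log₂n⌋≤n (B ℕ.^ m) (ℕ.m^n≢0 B m)) ⟩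
    (B ℕ.^ m) ℕ.^ n       ≡⟨ ℕ.^-*-assoc B m n ⟩
    B ℕ.^ (m ℕ.* n)       ≡⟨ cong (B ℕ.^_) (ℕ.*-comm m n) ⟩
    B ℕ.^ (n ℕ.* m)       ≡⟨ ℕ.^-*-assoc B n m ⟨
    (B ℕ.^ n) ℕ.^ m       ≤⟨ ℕ.^-monoˡ-≤ m (ℕ.<⇒≤ (n<2^[1+⌊log₂n⌋] (B ℕ.^ n))) ⟩
    (2 ℕ.^ suc b) ℕ.^ m   ≡⟨ ℕ.^-*-assoc 2 (suc b) m ⟩
    2 ℕ.^ (suc b ℕ.* m)   <⟨ ℕ.^-monoʳ-< 2 ℕ.≤-refl lt ⟩
    2 ℕ.^ (a ℕ.* n)       ∎)
    where
    open ℕ.≤-Reasoning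
    a = ⌊log₂ (B ℕ.^ m) ⌋
    b = ⌊log₂ (B ℕ.^ n) ⌋

-- Since ⌊log₂ Bᵏ⌋ ≤ k log₂ B < ⌊log₂ Bᵏ⌋ + 1, the rational ⌊log₂ Bᵏ⌋ / k
-- approximates log₂ B to within 1/k.
log₂ : (B : ℕ) .{{_ : NonZero B}} → ℝ
log₂ B .seq k = (+ ⌊log₂ (B ℕ.^ suc k) ⌋) ℚ./ suc k
log₂ B .cauchy ε ε>0 with archimedean ε ε>0
... | N , small = N , λ m n ≤m ≤n → ∣-∣<-intro (close m n ≤n)
    (subst (ℚ._< ε) (sym (swap-- (L m) (L n))) (close n m ≤m))
  where
  open ℚ.≤-Reasoning
  L : ℕ → ℚ
  L k = (+ ⌊log₂ (B ℕ.^ suc k) ⌋) ℚ./ suc k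
  close : ∀ m n → N ℕ.≤ n → L m ℚ.- L n ℚ.< ε
  close m n ≤n = begin-strict
    L m ℚ.- L n
      ≤⟨ ℚ.+-monoˡ-≤ (ℚ.- L n) (/-cross-≤ ⌊log₂ (B ℕ.^ suc m) ⌋ (suc ⌊log₂ (B ℕ.^ suc n) ⌋) m n
           (⌊log₂⌋-power-cross B (suc m) (suc n))) ⟩
    (+ suc ⌊log₂ (B ℕ.^ suc n) ⌋) ℚ./ suc n ℚ.- L n
      ≡⟨ cong (ℚ._- L n) (/-suc ⌊log₂ (B ℕ.^ suc n) ⌋ n) ⟩
    (L n ℚ.+ (+ 1) ℚ./ suc n) ℚ.- L n
      ≡⟨ cancel-- (L n) ((+ 1) ℚ./ suc n) ⟩
    (+ 1) ℚ./ suc n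
      <⟨ small n ≤n ⟩
    ε ∎

χ : ∀ {n} → Fin n → Vec ℕ n
χ {n} i = replicate n 0 [ i ]≔ 1

_⊕_ : ∀ {n} → Vec ℕ n → Vec ℕ n → Vec ℕ n
_⊕_ = zipWith ℕ._+_

DRSubmodular : ∀ {n} → (Vec ℕ n → ℝ₊) → Set
DRSubmodular {n} f = ∀ (x y : Vec ℕ n) → Pointwise ℕ._≤_ x y → ∀ (i : Fin n) →
  value (f (x ⊕ χ i)) - value (f x) ≥ value (f (y ⊕ χ i)) - value (f y)

-- A 0/1-vector indexed by S is a function S → Bool.
module _ {S : Set} (_≟_ : DecidableEquality S) where

  -- Coordinatewise disjunction with the indicator vector of e; when y e is
  -- false this is the sum of y and that indicator vector.
  insert : S → (S → Bool) → (S → Bool)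
  insert e y e′ = y e′ ∨ does (e ≟ e′)

  Submodular : ((S → Bool) → ℝ₊) → Set
  Submodular g = ∀ (y y′ : S → Bool) → (∀ s → y s Bool.≤ y′ s) →
    ∀ (e : S) → y′ e ≡ false →
    value (g (insert e y)) - value (g y) ≥ value (g (insert e y′)) - value (g y′)

subsetSum : ∀ {t} → Vector ℕ t → (Fin t → Bool) → ℕ
subsetSum {t} a y = ∑[ j < t ] ((if y j then 1 else 0) ℕ.* a j)

record IsDecomposition (B : ℕ) .{{_ : NonZero B}} {t : ℕ} (a : Vector ℕ t) : Set where
  field
    positive  : ∀ j → 0 ℕ.< a j
    sums-to-B : sum a ≡ B
    short     : fromℕ t ≤ 2 · log₂ B + 1ℝ
    complete  : ∀ q → q ℕ.≤ B → ∃[ y ] subsetSum a y ≡ q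

E′ : ∀ {n} → (Fin n → ℕ) → Set
E′ {n} t = Σ (Fin n) λ i → Fin (t i)

_≟-E′_ : ∀ {n} {t : Fin n → ℕ} → DecidableEquality (E′ t)
_≟-E′_ = Product.≡-dec Fin._≟_ Fin._≟_

module _ {n : ℕ} {t : Fin n → ℕ} (a : ∀ i → Vector ℕ (t i)) where

  toLattice : (E′ t → Bool) → Vec ℕ n
  toLattice y = tabulate λ i → subsetSum (a i) (λ j → y (i , j))

  pullback : (Vec ℕ n → ℝ₊) → (E′ t → Bool) → ℝ₊
  pullback f y = f (toLattice y)

{-# OPTIONS --safe #-}

-- Since y e = false, adding e = (i , j) to y raises coordinate i of the lattice
-- point by exactly a i j, so the marginal gain of g at y is a telescoping sum of
-- a i j unit gains of f in direction i.  Comparing these unit gains at two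
-- comparable lattice points, step by step, is diminishing returns for f.
module Submission where

open import Defs
open import Algebra.Properties.CommutativeMonoid.Sum as CommutativeMonoidSum using ()
open import Data.Bool.Base as Bool using (Bool; true; false; _∨_; if_then_else_; f≤t; b≤b)
open import Data.Bool.Properties using (∨-identityʳ; ∨-zeroʳ)
open import Data.Nat.Base as ℕ using (ℕ; zero; suc; NonZero; z≤n)
import Data.Nat.Properties as ℕ
open import Data.Fin.Base using (Fin; zero; suc; punchIn)
open import Data.Fin.Properties using (_≟_; punchInᵢ≢i)
open import Data.Product.Base using (_,_; proj₁)
open import Data.Rational.Base as ℚ using (0ℚ; ½)
import Data.Rational.Properties as ℚ
open import Data.Rational.Solver using (module +-*-Solver)
open import Data.Vec.Base using (Vec; _∷_; lookup; tabulate; updateAt)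
open import Data.Vec.Properties
  using ( updateAt-id; updateAt-updateAt; lookup∘updateAt; lookup∘updateAt′
        ; lookup∘tabulate; tabulate∘lookup; tabulate-cong; zipWith-identityʳ)
open import Data.Vec.Functional using (Vector; removeAt)
open import Data.Vec.Relation.Binary.Pointwise.Inductive using (Pointwise; _∷_; tabulate⁺)
open import Function.Base using (_∘_)
open import Relation.Binary.PropositionalEquality
  using (_≡_; _≢_; refl; sym; trans; cong; cong₂; subst; subst₂; module ≡-Reasoning)
open import Relation.Nullary.Decidable.Core using (yes; no)
open import Relation.Nullary.Decidable using (dec-true; dec-false)

open CommutativeMonoidSum ℕ.+-0-commutativeMonoid using (sum; sum-remove; sum-cong-≗)

≤-false : ∀ {b c} → b Bool.≤ c → c ≡ false → b ≡ false
-- The case `f≤t` cannot occur: there `c` is `true`.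
≤-false b≤b c≡false = c≡false

-- Both sides vanish term by term, so any slack `ε` suffices. It serves as the base case with no
-- unit steps.
x-x≤y-y : ∀ x y → x - x ≤ y - y
x-x≤y-y x y ε ε>0 = 0 , λ n _ → begin
  seq x n ℚ.- seq x n          ≡⟨ ℚ.+-inverseʳ (seq x n) ⟩
  0ℚ                           ≤⟨ ℚ.<⇒≤ ε>0 ⟩
  ε                            ≡⟨ ℚ.+-identityˡ ε ⟨
  0ℚ ℚ.+ ε                     ≡⟨ cong (ℚ._+ ε) (ℚ.+-inverseʳ (seq y n)) ⟨
  seq y n ℚ.- seq y n ℚ.+ ε    ∎
  where open ℚ.≤-Reasoning

-- Adding the two comparisons cancels the middle values `x₁` and `y₁`, so consecutive increments can
-- be chained.
differences-telescope : ∀ x₀ x₁ x₂ y₀ y₁ y₂ →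
  y₁ - y₀ ≤ x₁ - x₀ → y₂ - y₁ ≤ x₂ - x₁ → y₂ - y₀ ≤ x₂ - x₀
differences-telescope x₀ x₁ x₂ y₀ y₁ y₂ p q ε ε>0
  -- Each comparison gets half the tolerance; `telescopeʳ` adds the halves up to `ε`.
  with p (½ ℚ.* ε) ½ε>0 | q (½ ℚ.* ε) ½ε>0
  where
  ½ε>0 : 0ℚ ℚ.< ½ ℚ.* ε
  ½ε>0 = subst (ℚ._< ½ ℚ.* ε) (ℚ.*-zeroʳ ½) (ℚ.*-monoʳ-<-pos ½ ε>0)
... | M , p′ | N , q′ = M ℕ.⊔ N , λ n le → subst₂ ℚ._≤_
    (telescopeˡ (seq y₀ n) (seq y₁ n) (seq y₂ n))
    (telescopeʳ (seq x₀ n) (seq x₁ n) (seq x₂ n) ε)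
    (ℚ.+-mono-≤ (p′ n (ℕ.m⊔n≤o⇒m≤o M N le)) (q′ n (ℕ.m⊔n≤o⇒n≤o M N le)))
  where
  open +-*-Solver
  telescopeˡ : ∀ a b c → (b ℚ.- a) ℚ.+ (c ℚ.- b) ≡ c ℚ.- a
  telescopeˡ = solve 3 (λ a b c → (b :- a) :+ (c :- b) := c :- a) refl

  telescopeʳ : ∀ a b c δ →
    (b ℚ.- a ℚ.+ ½ ℚ.* δ) ℚ.+ (c ℚ.- b ℚ.+ ½ ℚ.* δ) ≡ c ℚ.- a ℚ.+ δ
  telescopeʳ = solve 4 (λ a b c δ →
    (b :- a :+ con ½ :* δ) :+ (c :- b :+ con ½ :* δ) := c :- a :+ δ) refl

-- In the form of a one-coordinate update, repeated unit steps in the same direction can be fused.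
⊕-χ : ∀ {n} (x : Vec ℕ n) i → x ⊕ χ i ≡ updateAt x i suc
⊕-χ (k ∷ x) zero    = cong₂ _∷_ (ℕ.+-comm k 1) (zipWith-identityʳ ℕ.+-identityʳ x)
⊕-χ (k ∷ x) (suc i) = cong₂ _∷_ (ℕ.+-identityʳ k) (⊕-χ x i)

updateAt-+-zero : ∀ {n} (x : Vec ℕ n) i → updateAt x i (0 ℕ.+_) ≡ x
updateAt-+-zero x i = updateAt-id i x

updateAt-+-suc : ∀ {n} (x : Vec ℕ n) i k →
  updateAt x i (suc k ℕ.+_) ≡ updateAt x i (k ℕ.+_) ⊕ χ i
updateAt-+-suc x i k =
  -- The fused update is `suc ∘ (k ℕ.+_)`, which computes to `suc k ℕ.+_`.
  sym (trans (⊕-χ (updateAt x i (k ℕ.+_)) i) (updateAt-updateAt i x))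

updateAt-+-mono : ∀ {n} {x y : Vec ℕ n} i k → Pointwise ℕ._≤_ x y →
  Pointwise ℕ._≤_ (updateAt x i (k ℕ.+_)) (updateAt y i (k ℕ.+_))
updateAt-+-mono zero    k (p ∷ ps) = ℕ.+-monoʳ-≤ k p ∷ ps
updateAt-+-mono (suc i) k (p ∷ ps) = p ∷ updateAt-+-mono i k ps

-- Induction on `k`: the gain of `suc k` steps is the gain of the first `k` steps plus one unit
-- gain, which `dr` compares.
DRSubmodular-+ : ∀ {n} (f : Vec ℕ n → ℝ₊) → DRSubmodular f →
  ∀ {x y} → Pointwise ℕ._≤_ x y → ∀ i k →
  value (f (updateAt x i (k ℕ.+_))) - value (f x) ≥
  value (f (updateAt y i (k ℕ.+_))) - value (f y)
DRSubmodular-+ f dr {x} {y} x≤y i zero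
  rewrite updateAt-+-zero x i | updateAt-+-zero y i = x-x≤y-y (value (f y)) (value (f x))
DRSubmodular-+ f dr {x} {y} x≤y i (suc k)
  rewrite updateAt-+-suc x i k | updateAt-+-suc y i k =
  differences-telescope
    (value (f x)) (value (f x′)) (value (f (x′ ⊕ χ i)))
    (value (f y)) (value (f y′)) (value (f (y′ ⊕ χ i)))
    (DRSubmodular-+ f dr x≤y i k)
    -- Both points have moved by the same `k` in coordinate `i`, so they remain comparable.
    (dr x′ y′ (updateAt-+-mono i k x≤y) i)
  where
  x′ = updateAt x i (k ℕ.+_)
  y′ = updateAt y i (k ℕ.+_)

-- Vectors with equal lookups are equal, so it is enough to compare entries at `i` and away from
-- `i`.
tabulate-updateAt : ∀ {A : Set} {n} {F G : Fin n → A} {h : A → A} i →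
  G i ≡ h (F i) → (∀ l → l ≢ i → G l ≡ F l) →
  tabulate G ≡ updateAt (tabulate F) i h
tabulate-updateAt {F = F} {G} {h} i at-i off-i =
  trans (tabulate-cong agree) (tabulate∘lookup (updateAt (tabulate F) i h))
  where
  agree : ∀ l → G l ≡ lookup (updateAt (tabulate F) i h) l
  agree l with l ≟ i
  ... | yes refl = trans at-i (sym
        (trans (lookup∘updateAt i (tabulate F)) (cong h (lookup∘tabulate F i))))
  ... | no l≢i   = trans (off-i l l≢i) (sym
        (trans (lookup∘updateAt′ l i l≢i (tabulate F)) (lookup∘tabulate F l)))

sum-mono-≤ : ∀ {t} {a b : Vector ℕ t} → (∀ j → a j ℕ.≤ b j) → sum a ℕ.≤ sum b
sum-mono-≤ {zero}  a≤b = z≤n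
sum-mono-≤ {suc t} a≤b = ℕ.+-mono-≤ (a≤b zero) (sum-mono-≤ (a≤b ∘ suc))

subsetSum-mono : ∀ {t} (a : Vector ℕ t) {y z} → (∀ j → y j Bool.≤ z j) →
  subsetSum a y ℕ.≤ subsetSum a z
subsetSum-mono a y≤z = sum-mono-≤ λ j → ℕ.*-monoˡ-≤ (a j) (indicator-mono (y≤z j))
  where
  indicator-mono : ∀ {b c} → b Bool.≤ c → (if b then 1 else 0) ℕ.≤ (if c then 1 else 0)
  indicator-mono f≤t = z≤n
  indicator-mono b≤b = ℕ.≤-refl

subsetSum-cong : ∀ {t} (a : Vector ℕ t) {y z} → (∀ j → y j ≡ z j) →
  subsetSum a y ≡ subsetSum a z
subsetSum-cong a y≡z = sum-cong-≗ λ j → cong (λ b → (if b then 1 else 0) ℕ.* a j) (y≡z j)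

-- Once the term at `j` is split off, the remaining terms of both sums coincide, since `punchIn j`
-- never hits `j`.
subsetSum-add : ∀ {t} (a : Vector ℕ t) {y z} j → y j ≡ false → z j ≡ true →
  (∀ l → l ≢ j → z l ≡ y l) → subsetSum a z ≡ a j ℕ.+ subsetSum a y
subsetSum-add {suc t} a {y} {z} j yj zj off-j = begin
  subsetSum a z
    ≡⟨ sum-remove {i = j} (term z) ⟩
  term z j ℕ.+ sum (removeAt (term z) j)
    ≡⟨ cong₂ ℕ._+_ (trans (cong (λ b → indicator b ℕ.* a j) zj) (ℕ.*-identityˡ (a j)))
         (subsetSum-cong (removeAt a j) λ l → off-j (punchIn j l) (punchInᵢ≢i j l)) ⟩
  a j ℕ.+ sum (removeAt (term y) j)
    -- Since `y j` is `false`, its term is zero and can be put back into the sum.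
    ≡⟨ cong (λ b → a j ℕ.+ (indicator b ℕ.* a j ℕ.+ sum (removeAt (term y) j))) yj ⟨
  a j ℕ.+ (term y j ℕ.+ sum (removeAt (term y) j))
    ≡⟨ cong (a j ℕ.+_) (sum-remove {i = j} (term y)) ⟨
  a j ℕ.+ subsetSum a y ∎
  where
  open ≡-Reasoning
  indicator : Bool → ℕ
  indicator b = if b then 1 else 0
  term : (Fin (suc t) → Bool) → Vector ℕ (suc t)
  term w l = indicator (w l) ℕ.* a l

module _ {n} {t : Fin n → ℕ} where

  insert-self : ∀ (e : E′ t) y → insert _≟-E′_ e y e ≡ true
  insert-self e y = trans (cong (y e ∨_) (dec-true (e ≟-E′ e) refl)) (∨-zeroʳ (y e))

  insert-other : ∀ (e : E′ t) y {e′} → e ≢ e′ → insert _≟-E′_ e y e′ ≡ y e′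
  insert-other e y {e′} e≢e′ =
    trans (cong (y e′ ∨_) (dec-false (e ≟-E′ e′) e≢e′)) (∨-identityʳ (y e′))

  toLattice-mono : ∀ (a : ∀ i → Vector ℕ (t i)) {y z} → (∀ s → y s Bool.≤ z s) →
    Pointwise ℕ._≤_ (toLattice a y) (toLattice a z)
  toLattice-mono a y≤z = tabulate⁺ λ i → subsetSum-mono (a i) λ j → y≤z (i , j)

  toLattice-insert : ∀ (a : ∀ i → Vector ℕ (t i)) i j y → y (i , j) ≡ false →
    toLattice a (insert _≟-E′_ (i , j) y) ≡ updateAt (toLattice a y) i (a i j ℕ.+_)
  toLattice-insert a i j y ye = tabulate-updateAt i
    (subsetSum-add (a i) j ye (insert-self (i , j) y)
      λ l l≢j → insert-other (i , j) y λ { refl → l≢j refl })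
    -- Every index of block `l` differs from `(i , j)` in its first component, so the insertion
    -- leaves that block alone.
    (λ l l≢i → subsetSum-cong (a l) λ m →
      insert-other (i , j) y λ e≡ → l≢i (sym (cong proj₁ e≡)))

lemma3 : ∀ {n : ℕ} (f : Vec ℕ n → ℝ₊) → DRSubmodular f →
    ∀ (B : Fin n → ℕ) (B≢0 : ∀ i → NonZero (B i)) →
    ∀ (t : Fin n → ℕ) (a : ∀ i → Vector ℕ (t i)) →
    (∀ i → IsDecomposition (B i) {{B≢0 i}} (a i)) →
    Submodular _≟-E′_ (pullback a f)
lemma3 f dr B B≢0 t a _ y y′ y≤y′ (i , j) y′e
  -- The element is absent from `y` too, because `y` lies below `y′`; hence both lattice points rise
  -- by the same `a i j`.
  rewrite toLattice-insert a i j y (≤-false (y≤y′ (i , j)) y′e)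
        | toLattice-insert a i j y′ y′e =
  DRSubmodular-+ f dr (toLattice-mono a y≤y′) i (a i j)
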